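{- Suppose $G$ is a graph with $k\ge 1$ pendant edges and maximum degree $\Delta(G)$. Then $\chi_{lt}(G)\ge \max\{\Delta(G)+1,\,k+1\}\ge 3$.
   Context: All graphs are finite, simple and loopless, of order $p=|V|\ge 3$ and size $q=|E|\ge 2$, with no isolated vertex and no $K_2$ component (graphs may be disconnected). A pendant vertex is a vertex of degree 1; a pendant edge is an edge incident to a pendant vertex. A local total antimagic labeling of $G=(V,E)$ is a bijection $f:V\cup E\to\{1,\dots,p+q\}$ such that, with weights $w_f(u)=\sum f(e)$ over all edges $e$ incident to $u$ for $u\in V$ (the label of $u$ itself is not included) and $w_f(uv)=f(u)+f(v)$ for $uv\in E$, one has: adjacent vertices have distinct weights, adjacent edges have distinct weights, and every vertex has a weight distinct from that of each of its incident edges. $\chi_{lt}(G)$ is the minimum, over all local total antimagic labelings $f$ of $G$, of the number of distinct values among all the vertex and edge weights (a lower bound on $\chi_{lt}(G)$ means that every local total antimagic labeling of $G$ has at least that many distinct weights). -}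

module Defs where

open import Data.Fin using (Fin; toℕ; _<_)
open import Data.Fin.Properties using (_≟_; any?)
open import Data.List using (List; length; filter; map; allFin; deduplicate; _++_)
open import Data.List.Extrema.Nat using (max)
open import Data.Nat as ℕ using (ℕ; suc; _+_; _≤_)
open import Data.Nat.ListAction using (sum)
open import Data.Product using (∃; ∃₂; _×_)
open import Data.Sum using (_⊎_; inj₁; inj₂)
open import Function.Bundles using (_⤖_; Bijection)
open import Relation.Binary.Construct.Closure.ReflexiveTransitive using (Star)
open import Relation.Binary.PropositionalEquality using (_≡_; _≢_)
open import Relation.Nullary using (Dec; ¬_)
open import Relation.Nullary.Decidable using (_×-dec_; _⊎-dec_)

-- A finite simple graph with vertex set Fin p and edge set Fin q.  The unordered
-- pair of endpoints of an edge is listed in increasing order, so `src<tgt` excludes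
-- loops and `simple` excludes parallel edges; the order carries no orientation.
record Graph : Set where
  field
    p q     : ℕ
    src tgt : Fin q → Fin p
    src<tgt : ∀ e → src e < tgt e
    simple  : ∀ e e′ → src e ≡ src e′ → tgt e ≡ tgt e′ → e ≡ e′

  V E : Set
  V = Fin p
  E = Fin q

  Incident : V → E → Set
  Incident u e = u ≡ src e ⊎ u ≡ tgt e

  incident? : ∀ u e → Dec (Incident u e)
  incident? u e = (u ≟ src e) ⊎-dec (u ≟ tgt e)

  incidentEdges : V → List E
  incidentEdges u = filter (incident? u) (allFin q)

  Adjacent : V → V → Set
  Adjacent u v = u ≢ v × ∃ λ e → Incident u e × Incident v e

  AdjacentEdges : E → E → Set
  AdjacentEdges e e′ = e ≢ e′ × ∃ λ u → Incident u e × Incident u e′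

  deg : V → ℕ
  deg u = length (incidentEdges u)

  Δ : ℕ
  Δ = max 0 (map deg (allFin p))

  Isolated : V → Set
  Isolated u = deg u ≡ 0

  -- {u , v} is the vertex set of a connected component, and u v is its edge.
  K₂Component : V → V → Set
  K₂Component u v = Adjacent u v × (∀ w → Star Adjacent u w → w ≡ u ⊎ w ≡ v)

  PendantVertex : V → Set
  PendantVertex u = deg u ≡ 1

  PendantEdge : E → Set
  PendantEdge e = ∃ λ u → Incident u e × PendantVertex u

  pendantEdge? : ∀ e → Dec (PendantEdge e)
  pendantEdge? e = any? λ u → incident? u e ×-dec (deg u ℕ.≟ 1)

  #pendantEdges : ℕ
  #pendantEdges = length (filter pendantEdge? (allFin q))

record Admissible (G : Graph) : Set where
  open Graph G
  field
    p≥3            : 3 ≤ p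
    q≥2            : 2 ≤ q
    noIsolated     : ¬ ∃ Isolated
    noK₂Component  : ¬ ∃₂ K₂Component

module _ (G : Graph) where
  open Graph G

  TotalLabeling : Set
  TotalLabeling = (V ⊎ E) ⤖ Fin (p + q)

module _ (G : Graph) (f : TotalLabeling G) where
  open Graph G

  -- Fin (p + q) is {0,…,p+q-1}; labels are 1,…,p+q.
  label : V ⊎ E → ℕ
  label x = suc (toℕ (Bijection.to f x))

  vertexWeight : V → ℕ
  vertexWeight u = sum (map (λ e → label (inj₂ e)) (incidentEdges u))

  edgeWeight : E → ℕ
  edgeWeight e = label (inj₁ (src e)) + label (inj₁ (tgt e))

  record IsLocalTotalAntimagic : Set where
    field
      vertices : ∀ u v → Adjacent u v → vertexWeight u ≢ vertexWeight v
      edges    : ∀ e e′ → AdjacentEdges e e′ → edgeWeight e ≢ edgeWeight e′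
      mixed    : ∀ u e → Incident u e → vertexWeight u ≢ edgeWeight e

  #weights : ℕ
  #weights = length (deduplicate ℕ._≟_
    (map vertexWeight (allFin p) ++ map edgeWeight (allFin q)))

-- m ≤χlt G says m ≤ χ_lt(G), where χ_lt(G) is the minimum of #weights G f over all
-- local total antimagic labelings f of G (vacuous if G has no such labeling).
_≤χlt_ : ℕ → Graph → Set
m ≤χlt G = (f : TotalLabeling G) → IsLocalTotalAntimagic G f → m ≤ #weights G f

{-# OPTIONS --safe #-}

-- A vertex weight and the weights of its incident edges are pairwise distinct, which
-- gives Δ + 1.  A pendant vertex has as weight the label of its pendant edge, so
-- the k pendant edges give k distinct weights; the other end v of the pendant
-- edge with the largest label has degree at least 2 (there is no K₂ component), so the
-- weight of v exceeds all of these.  The existence of v also shows Δ ≥ 2.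

module Submission where

open import Data.Nat using (ℕ; _+_; _≤_; _⊔_)
open import Data.Product using (_×_)
open import Relation.Binary.PropositionalEquality using (_≡_)
open import Defs

open import Data.Fin using (fromℕ<)
open import Data.Fin.Properties using (toℕ-injective) renaming (<⇒≢ to <ᶠ⇒≢)
open import Data.List using (List; []; _∷_; [_]; _++_; allFin; deduplicate; filter; length; map)
open import Data.List.Extrema.Nat
  using (argmax; argmax-all; f[⊥]≤f[argmax]; f[xs]≤f[argmax]; max<v⁺; xs≤max)
open import Data.List.Membership.Propositional using (_∈_)
open import Data.List.Membership.Propositional.Properties
open import Data.List.Properties using (length-++; length-map)
open import Data.List.Relation.Binary.Subset.Propositional using (_⊆_)
open import Data.List.Relation.Unary.All as All using (All; []; _∷_)
open import Data.List.Relation.Unary.All.Properties as All using (all-filter)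
open import Data.List.Relation.Unary.AllPairs using ([]; _∷_)
open import Data.List.Relation.Unary.Any using (here; there)
open import Data.List.Relation.Unary.Unique.Propositional using (Unique)
open import Data.List.Relation.Unary.Unique.Propositional.Properties as Unique using (allFin⁺)
open import Data.Nat as ℕ using (suc; _<_; z≤n; s≤s; z<s)
open import Data.Nat.ListAction using (sum)
open import Data.Nat.Properties
open import Data.Product using (∃; _,_; proj₂)
open import Data.Sum using (inj₁; inj₂)
open import Data.Sum.Properties using (inj₂-injective)
open import Function using (_∘_; Injective)
open import Function.Bundles using (Bijection)
open import Relation.Binary.Construct.Closure.ReflexiveTransitive using (Star; ε; _◅_)
open import Relation.Binary.PropositionalEquality
  using (_≢_; refl; sym; trans; cong; subst)
open import Relation.Nullary using (contradiction)

private
  variable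
    A B : Set
    x : A
    xs ys : List A

-- Deleting one occurrence of the head `x` from `ys` still leaves room for the tail, since `x` does
-- not recur in it. Both lower bounds on `#weights` come from this, applied to a duplicate-free list
-- of weights.
unique-⊆⇒length≤ : Unique xs → xs ⊆ ys → length xs ≤ length ys
unique-⊆⇒length≤ [] _ = z≤n
unique-⊆⇒length≤ {xs = x ∷ xs} (x∉xs ∷ xs!) x∷xs⊆ys
  with as , bs , refl ← ∈-∃++ (x∷xs⊆ys (here refl)) = begin
    suc (length xs)               ≤⟨ s≤s (unique-⊆⇒length≤ xs! xs⊆as++bs) ⟩
    suc (length (as ++ bs))       ≡⟨ cong suc (length-++ as) ⟩
    suc (length as + length bs)   ≡⟨ sym (+-suc (length as) (length bs)) ⟩
    length as + suc (length bs)   ≡⟨ sym (length-++ as) ⟩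
    length (as ++ [ x ] ++ bs)    ∎
  where
  open ≤-Reasoning
  xs⊆as++bs : xs ⊆ as ++ bs
  xs⊆as++bs y∈xs with ∈-++⁻ as (x∷xs⊆ys (there y∈xs))
  ... | inj₁ y∈as         = ∈-++⁺ˡ y∈as
  ... | inj₂ (here refl)  = contradiction refl (All.lookup x∉xs y∈xs)
  ... | inj₂ (there y∈bs) = ∈-++⁺ʳ as y∈bs

-- Injectivity is asked only among elements satisfying `P`, because edge weights are known to differ
-- only for edges sharing a vertex; `P` will be incidence with a fixed vertex.
unique-map⁺-on : {P : A → Set} {f : A → B} →
  (∀ {x y} → P x → P y → x ≢ y → f x ≢ f y) →
  All P xs → Unique xs → Unique (map f xs)
unique-map⁺-on f-sep [] [] = []
unique-map⁺-on f-sep (px ∷ pxs) (x∉xs ∷ xs!) =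
  All.map⁺ (All.zipWith (λ (py , x≢y) → f-sep px py x≢y) (pxs , x∉xs)) ∷
  unique-map⁺-on f-sep pxs xs!

length≡1⇒≡[_] : x ∈ xs → length xs ≡ 1 → xs ≡ [ x ]
length≡1⇒≡[_] {xs = _ ∷ []} (here refl) refl = refl

∈⇒≤sum-map : (f : A → ℕ) → x ∈ xs → f x ≤ sum (map f xs)
∈⇒≤sum-map f (here refl) = m≤m+n _ _
∈⇒≤sum-map f (there x∈xs) = ≤-trans (∈⇒≤sum-map f x∈xs) (m≤n+m _ _)

-- A second entry contributes a positive summand. This makes the weight of a vertex of degree at
-- least 2 exceed the label of each edge at it.
∈⇒<sum-map : (f : A → ℕ) → (∀ y → 0 < f y) → x ∈ xs → 2 ≤ length xs → f x < sum (map f xs)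
∈⇒<sum-map {xs = x ∷ y ∷ _} f f>0 (here refl) _ =
  m<m+n (f x) (≤-trans (f>0 y) (m≤m+n _ _))
∈⇒<sum-map {xs = y ∷ _} f f>0 (there x∈xs) _ =
  -- The goal unfolds to `suc (f x) ≤ f y + _`: the head supplies the 1, the tail supplies `f x`.
  +-mono-≤ (f>0 y) (∈⇒≤sum-map f x∈xs)
∈⇒<sum-map {xs = _ ∷ []} f f>0 (here refl) (s≤s ())

module _ (G : Graph) where
  open Graph G

  ∈-incidentEdges⁺ : ∀ {u e} → Incident u e → e ∈ incidentEdges u
  ∈-incidentEdges⁺ {u} {e} = ∈-filter⁺ (incident? u) (∈-allFin e)

  incidentEdges≡[_] : ∀ {u e} → Incident u e → deg u ≡ 1 → incidentEdges u ≡ [ e ]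
  incidentEdges≡[ u∈e ] = length≡1⇒≡[ ∈-incidentEdges⁺ u∈e ]

  pendant-edge-unique : ∀ {u e e′} → deg u ≡ 1 → Incident u e → Incident u e′ → e′ ≡ e
  pendant-edge-unique {e′ = e′} d≡1 u∈e u∈e′
    with here e′≡e ← subst (e′ ∈_) (incidentEdges≡[ u∈e ] d≡1) (∈-incidentEdges⁺ u∈e′) = e′≡e

  deg≢0 : ∀ {u e} → Incident u e → deg u ≢ 0
  deg≢0 {u} u∈e d≡0 with incidentEdges u | ∈-incidentEdges⁺ u∈e
  ... | _ ∷ _ | _ = contradiction d≡0 λ ()

  deg≢1⇒2≤deg : ∀ {u e} → Incident u e → deg u ≢ 1 → 2 ≤ deg u
  deg≢1⇒2≤deg u∈e d≢1 = ≤∧≢⇒< (n≢0⇒n>0 (deg≢0 u∈e)) (d≢1 ∘ sym)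

  -- Each end has `e` as its only edge, so a walk starting at an end of `e` can traverse nothing but
  -- `e`.
  both-ends-pendant⇒K₂ : ∀ e → deg (src e) ≡ 1 → deg (tgt e) ≡ 1 → K₂Component (src e) (tgt e)
  both-ends-pendant⇒K₂ e ds dt =
    (<ᶠ⇒≢ (src<tgt e) , e , inj₁ refl , inj₂ refl) , λ _ → closed (inj₁ refl)
    where
    end-deg : ∀ {u} → Incident u e → deg u ≡ 1
    end-deg (inj₁ refl) = ds
    end-deg (inj₂ refl) = dt

    -- The start is any end of `e`, so that the induction survives a step to the other end;
    -- `Incident w e` unfolds to the disjunction required by `K₂Component`.
    closed : ∀ {u w} → Incident u e → Star Adjacent u w → Incident w e
    closed u∈e ε = u∈e
    closed u∈e ((_ , e′ , u∈e′ , v∈e′) ◅ v⟶w)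
      with refl ← pendant-edge-unique (end-deg u∈e) u∈e u∈e′ = closed v∈e′ v⟶w

  pendant⇒non-pendant-end : Admissible G → ∀ {e} → PendantEdge e →
    ∃ λ v → Incident v e × 2 ≤ deg v
  pendant⇒non-pendant-end adm {e} (_ , inj₁ refl , ds) =
    tgt e , inj₂ refl , deg≢1⇒2≤deg (inj₂ refl) λ dt →
      Admissible.noK₂Component adm (_ , _ , both-ends-pendant⇒K₂ e ds dt)
  pendant⇒non-pendant-end adm {e} (_ , inj₂ refl , dt) =
    src e , inj₁ refl , deg≢1⇒2≤deg (inj₁ refl) λ ds →
      Admissible.noK₂Component adm (_ , _ , both-ends-pendant⇒K₂ e ds dt)

  deg≤Δ : ∀ v → deg v ≤ Δ
  deg≤Δ v = All.lookup (xs≤max 0 (map deg (allFin p))) (∈-map⁺ deg (∈-allFin v))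

  pendantEdges : List E
  pendantEdges = filter pendantEdge? (allFin q)

  module _ (f : TotalLabeling G) where

    edgeLabel : E → ℕ
    edgeLabel e = label G f (inj₂ e)

    edgeLabel-injective : Injective _≡_ _≡_ edgeLabel
    edgeLabel-injective =
      inj₂-injective ∘ Bijection.injective f ∘ toℕ-injective ∘ suc-injective

    weights : List ℕ
    weights = deduplicate ℕ._≟_
      (map (vertexWeight G f) (allFin p) ++ map (edgeWeight G f) (allFin q))

    vertexWeight∈weights : ∀ u → vertexWeight G f u ∈ weights
    vertexWeight∈weights u =
      ∈-deduplicate⁺ ℕ._≟_ (∈-++⁺ˡ (∈-map⁺ (vertexWeight G f) (∈-allFin u)))

    edgeWeight∈weights : ∀ e → edgeWeight G f e ∈ weights
    edgeWeight∈weights e =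
      ∈-deduplicate⁺ ℕ._≟_ (∈-++⁺ʳ _ (∈-map⁺ (edgeWeight G f) (∈-allFin e)))

    pendant⇒edgeLabel∈weights : ∀ {e} → PendantEdge e → edgeLabel e ∈ weights
    pendant⇒edgeLabel∈weights {e} (u , u∈e , d≡1) =
      subst (_∈ weights) w≡label (vertexWeight∈weights u)
      where
      w≡label : vertexWeight G f u ≡ edgeLabel e
      w≡label = trans (cong (sum ∘ map edgeLabel) (incidentEdges≡[ u∈e ] d≡1)) (+-identityʳ _)

    deg<#weights : IsLocalTotalAntimagic G f → ∀ v → deg v < #weights G f
    deg<#weights lta v = begin-strict
      deg v                                            ≡⟨ sym (length-map (edgeWeight G f) (incidentEdges v)) ⟩
      -- `star` has one more entry than this list, so `≤` for `star` is the strict inequality here.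
      length (map (edgeWeight G f) (incidentEdges v))  <⟨ unique-⊆⇒length≤ star-unique star⊆weights ⟩
      #weights G f                                     ∎
      where
      open ≤-Reasoning
      open IsLocalTotalAntimagic lta

      star : List ℕ
      star = vertexWeight G f v ∷ map (edgeWeight G f) (incidentEdges v)

      -- `mixed` separates the weight of `v` from those of its edges; distinct edges at `v` are
      -- adjacent through `v`, so `edges` separates their weights.
      star-unique : Unique star
      star-unique =
        All.map⁺ (All.map (mixed v _) (all-filter (incident? v) (allFin q))) ∷
        unique-map⁺-on (λ v∈e v∈e′ e≢e′ → edges _ _ (e≢e′ , v , v∈e , v∈e′))
          (all-filter (incident? v) (allFin q))
          (Unique.filter⁺ (incident? v) (allFin⁺ q))

      star⊆weights : star ⊆ weights
      star⊆weights (here refl) = vertexWeight∈weights v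
      star⊆weights (there w∈) with e , _ , refl ← ∈-map⁻ (edgeWeight G f) w∈ = edgeWeight∈weights e

    Δ<#weights : Admissible G → IsLocalTotalAntimagic G f → Δ < #weights G f
    Δ<#weights adm lta =
      -- The default value 0 of the maximum must also lie below `#weights`; any vertex shows this.
      max<v⁺ (≤-<-trans z≤n (deg<#weights lta v₀))
        (All.map⁺ (All.universal (deg<#weights lta) (allFin p)))
      where
      v₀ : V
      v₀ = fromℕ< (≤-trans z<s (Admissible.p≥3 adm))

    largest-pendantEdge : 1 ≤ #pendantEdges →
      ∃ λ e → PendantEdge e × (∀ {e′} → e′ ∈ pendantEdges → edgeLabel e′ ≤ edgeLabel e)
    largest-pendantEdge 1≤k with pendantEdges | all-filter pendantEdge? (allFin q)
    ... | e₀ ∷ es | pe₀ ∷ pes =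
      -- `e₀` serves as the default of `argmax`, so the bound is assembled from the default and from
      -- the remaining edges.
      argmax edgeLabel e₀ es , argmax-all edgeLabel pe₀ pes ,
      All.lookup (f[⊥]≤f[argmax] {f = edgeLabel} e₀ es ∷
                 f[xs]≤f[argmax] {f = edgeLabel} e₀ es)

    #pendantEdges<#weights : Admissible G → 1 ≤ #pendantEdges → #pendantEdges < #weights G f
    #pendantEdges<#weights adm 1≤k
      with e , pe , e-largest ← largest-pendantEdge 1≤k
      with v , v∈e , 2≤d ← pendant⇒non-pendant-end adm pe = begin-strict
        #pendantEdges                        ≡⟨ sym (length-map edgeLabel pendantEdges) ⟩
        length (map edgeLabel pendantEdges)  <⟨ unique-⊆⇒length≤ ∷-unique ⊆weights ⟩
        #weights G f                         ∎
      where
      open ≤-Reasoning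

      v-heavier : ∀ {e′} → e′ ∈ pendantEdges → vertexWeight G f v ≢ edgeLabel e′
      -- The label of `e′` is at most that of `e`, which is only one of at least two positive
      -- summands in the weight of `v`.
      v-heavier e′∈ = >⇒≢ (≤-<-trans (e-largest e′∈)
        (∈⇒<sum-map edgeLabel (λ _ → z<s) (∈-incidentEdges⁺ v∈e) 2≤d))

      ∷-unique : Unique (vertexWeight G f v ∷ map edgeLabel pendantEdges)
      ∷-unique =
        All.map⁺ (All.tabulate v-heavier) ∷
        -- Distinct pendant edges have distinct labels because the labeling is a bijection.
        Unique.map⁺ edgeLabel-injective (Unique.filter⁺ pendantEdge? (allFin⁺ q))

      ⊆weights : vertexWeight G f v ∷ map edgeLabel pendantEdges ⊆ weights
      ⊆weights (here refl) = vertexWeight∈weights v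
      ⊆weights (there w∈) with e′ , e′∈ , refl ← ∈-map⁻ edgeLabel w∈ =
        pendant⇒edgeLabel∈weights (proj₂ (∈-filter⁻ pendantEdge? {xs = allFin q} e′∈))

  2≤Δ : Admissible G → 1 ≤ #pendantEdges → 2 ≤ Δ
  2≤Δ adm 1≤k with pendantEdges | all-filter pendantEdge? (allFin q)
  ... | _ ∷ _ | pe ∷ _ with v , _ , 2≤d ← pendant⇒non-pendant-end adm pe = ≤-trans 2≤d (deg≤Δ v)

corollary2p2 : (G : Graph) → Admissible G → (k : ℕ) → Graph.#pendantEdges G ≡ k → 1 ≤ k →
    (((Graph.Δ G + 1) ⊔ (k + 1)) ≤χlt G) × (3 ≤ (Graph.Δ G + 1) ⊔ (k + 1))
corollary2p2 G adm k refl 1≤k =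
  (λ f lta → ⊔-lub (<⇒+1≤ (Δ<#weights G f adm lta)) (<⇒+1≤ (#pendantEdges<#weights G f adm 1≤k))) ,
  -- The left operand of the maximum suffices: `2 ≤ Δ` gives `3 ≤ Δ + 1`.
  ≤-trans (+-monoˡ-≤ 1 (2≤Δ G adm 1≤k)) (m≤m⊔n _ _)
  where
  <⇒+1≤ : ∀ {m n} → m < n → m + 1 ≤ n
  <⇒+1≤ {m} {n} = subst (_≤ n) (+-comm 1 m)
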